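{- For all hypercontracts $\mathcal{C}=(\mathcal{E},\mathcal{I})$ and $\mathcal{C}''=(\mathcal{E}'',\mathcal{I}'')$ in $\mathbf{Contr}$, the hypercontract quotient $\mathcal{C}''/\mathcal{C}$ is given, up to equivalence of hypercontracts, by $$\mathcal{C}''/\mathcal{C} = \left((\mathcal{C}'')^{ -1}\parallel \mathcal{C}\right)^{ -1}.$$ That is, for every $\mathcal{C}'\in\mathbf{Contr}$, $\mathcal{C}\parallel\mathcal{C}'\le\mathcal{C}''$ if and only if $\mathcal{C}'\le\left((\mathcal{C}'')^{ -1}\parallel\mathcal{C}\right)^{ -1}$.
   Context: Components. $(\mathbb{M},\le)$ is a preorder whose elements are called components, with a partial binary operation $\parallel$ (composition) that is associative, commutative, and monotonic in both arguments. Compsets. $\mathbf{CmpSet}$ is a lattice whose elements (compsets) are certain sets of components, ordered by inclusion: $H\le H'$ means $H\subseteq H'$ (meet and join need not be intersection and union). Composition of compsets is $H\parallel H'=\{M\parallel M' : M\in H,\ M'\in H',\ M \text{ and } M' \text{ composable}\}$; it is total, monotonic, commutative and associative. Hypercontracts. $\mathbf{Contr}$ is a lattice whose elements (hypercontracts) are certain pairs $\mathcal{C}=(\mathcal{E},\mathcal{I})$ of compsets ($\mathcal{E}$: environments, $\mathcal{I}$: implementations). The order (refinement) is: $(\mathcal{E},\mathcal{I})\le(\mathcal{E}',\mathcal{I}')$ iff $\mathcal{E}'\le\mathcal{E}$ and $\mathcal{I}\le\mathcal{I}'$. Two hypercontracts are equivalent if each refines the other. Parallel composition. For $\mathcal{C}_1=(\mathcal{E}_1,\mathcal{I}_1)$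 and $\mathcal{C}_2=(\mathcal{E}_2,\mathcal{I}_2)$ in $\mathbf{Contr}$, $\mathcal{C}_1\parallel\mathcal{C}_2$ is the smallest hypercontract $(\mathcal{E}',\mathcal{I}')\in\mathbf{Contr}$ (up to equivalence) satisfying the three requirements $\mathcal{I}_1\parallel\mathcal{I}_2\le\mathcal{I}'$, $\ \mathcal{E}'\parallel\mathcal{I}_1\le\mathcal{E}_2$, $\ \mathcal{E}'\parallel\mathcal{I}_2\le\mathcal{E}_1$ (in particular it satisfies these requirements itself). Parallel compositions of elements of $\mathbf{Contr}$ are assumed to exist. Mirror (reciprocal). $(\mathcal{E},\mathcal{I})^{ -1}=(\mathcal{I},\mathcal{E})$. It is assumed that $\mathcal{C}^{ -1}\in\mathbf{Contr}$ for each $\mathcal{C}\in\mathbf{Contr}$, and that whenever the infimum of a collection of hypercontracts exists, $\left(\bigwedge_i\mathcal{C}_i\right)^{ -1}=\bigvee_i\mathcal{C}_i^{ -1}$. Quotient. $\mathcal{C}''/\mathcal{C}$ is the hypercontract defined (up to equivalence) by the universal property: for all $\mathcal{C}'\in\mathbf{Contr}$, $\mathcal{C}\parallel\mathcal{C}'\le\mathcal{C}''$ if and only if $\mathcal{C}'\le\mathcal{C}''/\mathcal{C}$. -}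

module Defs where

open import Level using (Level; suc; _⊔_)
open import Data.Product using (Σ; Σ-syntax; ∃; ∃-syntax; _×_; _,_; proj₁; proj₂; swap)
open import Data.Product.Relation.Binary.Pointwise.NonDependent using (Pointwise)
open import Function.Bundles using (_⇔_)
open import Relation.Binary.Core using (Rel)
open import Relation.Binary.Definitions using (Symmetric; _Respects_)
open import Relation.Binary.Structures using (IsPreorder)
open import Relation.Binary.Lattice.Structures using (IsLattice)
open import Relation.Binary.PropositionalEquality using (_≡_)
open import Relation.Unary using (Pred; _∈_; _⊆_; _≐_)

-- The partial operation is a function on composable pairs. Its last argument
-- is irrelevant, so the result depends only on the two components.

record ComponentTheory (ℓ : Level) : Set (suc ℓ) where
  field
    Component  : Set ℓ
    _≤_        : Rel Component ℓ
    isPreorder : IsPreorder _≡_ _≤_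

    Composable : Rel Component ℓ
    compose    : (M N : Component) → .(Composable M N) → Component

    -- Together with commutativity this also yields the converse direction:
    -- if M ∥ (N ∥ P) is defined, then so is (M ∥ N) ∥ P.
    associative : ∀ {M N P} (c : Composable M N) (d : Composable (compose M N c) P) →
                  Σ[ e ∈ Composable N P ] Σ[ f ∈ Composable M (compose N P e) ]
                    compose (compose M N c) P d ≡ compose M (compose N P e) f

    composable-sym : Symmetric Composable
    commutative    : ∀ {M N} (c : Composable M N) →
                     compose M N c ≡ compose N M (composable-sym c)

    monotonicˡ : ∀ {M M′ N} (c : Composable M N) (c′ : Composable M′ N) →
                 M ≤ M′ → compose M N c ≤ compose M′ N c′
    monotonicʳ : ∀ {M N N′} (c : Composable M N) (c′ : Composable M N′) →
                 N ≤ N′ → compose M N c ≤ compose M N′ c′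

  infixl 7 _∥ˢ_

  _∥ˢ_ : Pred Component ℓ → Pred Component ℓ → Pred Component ℓ
  (H ∥ˢ H′) P = ∃[ M ] ∃[ M′ ] (M ∈ H × M′ ∈ H′ ×
                  (Σ[ c ∈ Composable M M′ ] P ≡ compose M M′ c))

module CompsetNotions {ℓ s : Level} (𝕄 : ComponentTheory ℓ)
  (IsCompset : Pred (Pred (ComponentTheory.Component 𝕄) ℓ) s) where

  Compset : Set (suc ℓ ⊔ s)
  Compset = ∃ IsCompset

  infix 4 _≈_ _≤_

  _≤_ : Rel Compset ℓ
  H ≤ H′ = proj₁ H ⊆ proj₁ H′

  _≈_ : Rel Compset ℓ
  H ≈ H′ = proj₁ H ≐ proj₁ H′

record CompsetTheory {ℓ : Level} (𝕄 : ComponentTheory ℓ) (s : Level) : Set (suc (ℓ ⊔ s)) where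
  open ComponentTheory 𝕄 using (Component; _∥ˢ_)

  field
    IsCompset  : Pred (Pred Component ℓ) s
    -- Predicates stand for sets, so membership is invariant under having the
    -- same elements.
    extensional : IsCompset Respects _≐_

  open CompsetNotions 𝕄 IsCompset public

  field
    _∨_ _∧_   : Compset → Compset → Compset
    isLattice : IsLattice _≈_ _≤_ _∨_ _∧_

    ∥ˢ-closed : ∀ {H H′} → IsCompset H → IsCompset H′ → IsCompset (H ∥ˢ H′)

  infixl 7 _∥_

  _∥_ : Compset → Compset → Compset
  (H , h) ∥ (H′ , h′) = (H ∥ˢ H′) , ∥ˢ-closed h h′

module HypercontractNotions {ℓ s t : Level} {𝕄 : ComponentTheory ℓ} (𝕊 : CompsetTheory 𝕄 s)
  (IsContr : Pred (CompsetTheory.Compset 𝕊 × CompsetTheory.Compset 𝕊) t) where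

  private module S = CompsetTheory 𝕊

  Contr : Set (suc ℓ ⊔ s ⊔ t)
  Contr = ∃ IsContr

  environments implementations : Contr → S.Compset
  environments    ((E , I) , _) = E
  implementations ((E , I) , _) = I

  infix 4 _≈_ _≤_

  _≤_ : Rel Contr ℓ
  C ≤ C′ = (environments C′ S.≤ environments C) × (implementations C S.≤ implementations C′)

  _≈_ : Rel Contr ℓ
  C ≈ C′ = (C ≤ C′) × (C′ ≤ C)

  ParallelRequirements : Contr → Contr → Pred Contr ℓ
  ParallelRequirements ((E₁ , I₁) , _) ((E₂ , I₂) , _) ((E′ , I′) , _) =
    (I₁ S.∥ I₂ S.≤ I′) × (E′ S.∥ I₁ S.≤ E₂) × (E′ S.∥ I₂ S.≤ E₁)

  IsParallel : Contr → Contr → Pred Contr (suc ℓ ⊔ s ⊔ t)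
  IsParallel C₁ C₂ C = ParallelRequirements C₁ C₂ C ×
                       (∀ D → ParallelRequirements C₁ C₂ D → C ≤ D)

  IsInfimum IsSupremum : ∀ {i} {A : Set i} → (A → Contr) → Pred Contr (suc ℓ ⊔ s ⊔ t ⊔ i)
  IsInfimum  F C = (∀ a → C ≤ F a) × (∀ D → (∀ a → D ≤ F a) → D ≤ C)
  IsSupremum F C = (∀ a → F a ≤ C) × (∀ D → (∀ a → F a ≤ D) → C ≤ D)

record HypercontractTheory {ℓ s : Level} {𝕄 : ComponentTheory ℓ} (𝕊 : CompsetTheory 𝕄 s)
  (t : Level) : Set (suc (suc ℓ ⊔ s ⊔ t)) where
  private module S = CompsetTheory 𝕊

  field
    IsContr     : Pred (S.Compset × S.Compset) t
    extensional : IsContr Respects (Pointwise S._≈_ S._≈_)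

  open HypercontractNotions 𝕊 IsContr public

  field
    _∨_ _∧_   : Contr → Contr → Contr
    isLattice : IsLattice _≈_ _≤_ _∨_ _∧_

    parallel-exists : ∀ C₁ C₂ → ∃ (IsParallel C₁ C₂)

    mirror-closed : ∀ {E I} → IsContr (E , I) → IsContr (I , E)

  infixl 7 _∥_
  infix  8 _⁻¹

  _∥_ : Contr → Contr → Contr
  C₁ ∥ C₂ = proj₁ (parallel-exists C₁ C₂)

  _⁻¹ : Contr → Contr
  (EI , c) ⁻¹ = swap EI , mirror-closed c

  field
    mirror-infimum : {A : Set (suc ℓ ⊔ s ⊔ t)} (F : A → Contr) (C : Contr) →
                     IsInfimum F C → IsSupremum (λ a → F a ⁻¹) (C ⁻¹)

  -- IsQuotient C″ C Q says that Q is a quotient C″ / C.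
  IsQuotient : Contr → Contr → Pred Contr (suc ℓ ⊔ s ⊔ t)
  IsQuotient C″ C Q = ∀ C′ → (C ∥ C′ ≤ C″) ⇔ (C′ ≤ Q)

{-# OPTIONS --safe #-}
-- By minimality and monotonicity, C₁ ∥ C₂ ≤ D holds exactly when D itself meets
-- the three requirements. For C ∥ C′ ≤ C″ these are
--   I ∥ I′ ≤ I″,  E″ ∥ I ≤ E′,  E″ ∥ I′ ≤ E,
-- and for C″ ⁻¹ ∥ C ≤ C′ ⁻¹ they are the same three, permuted. Since the mirror
-- reverses refinement, the latter means C′ ≤ (C″ ⁻¹ ∥ C) ⁻¹.
module Submission where

open import Defs
open import Level using (Level)
open import Data.Product using (_×_; _,_; proj₁; proj₂; swap)
open import Function.Base using (_∘_)
open import Function.Bundles using (_⇔_; mk⇔; module Equivalence)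
open import Function.Properties.Equivalence using (⇔-setoid)
open import Relation.Binary.Lattice.Structures using (IsLattice)
open import Relation.Binary.PropositionalEquality using (trans)
open import Relation.Unary using (Pred; _⊆_)
import Relation.Binary.Reasoning.Setoid as SetoidReasoning

module _ {ℓ : Level} (𝕄 : ComponentTheory ℓ) where
  open ComponentTheory 𝕄

  ∥ˢ-comm-⊆ : (H K : Pred Component ℓ) → H ∥ˢ K ⊆ K ∥ˢ H
  ∥ˢ-comm-⊆ H K (M , N , M∈H , N∈K , c , P≡MN) =
    N , M , N∈K , M∈H , composable-sym c , trans P≡MN (commutative c)

  ∥ˢ-monoˡ-⊆ : {H H′ : Pred Component ℓ} (K : Pred Component ℓ) →
               H ⊆ H′ → H ∥ˢ K ⊆ H′ ∥ˢ K
  ∥ˢ-monoˡ-⊆ K H⊆H′ (M , N , M∈H , rest) = M , N , H⊆H′ M∈H , rest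

module _ {ℓ s t : Level} {𝕄 : ComponentTheory ℓ} {𝕊 : CompsetTheory 𝕄 s}
  (ℍ : HypercontractTheory 𝕊 t) where

  open HypercontractTheory ℍ

  private
    impl env : Contr → Pred (ComponentTheory.Component 𝕄) ℓ
    impl = proj₁ ∘ implementations
    env  = proj₁ ∘ environments

  -- `C₁ ∥ C₂` meets the requirements, and they are closed upwards: a larger hypercontract has more
  -- implementations and fewer environments, and the latter occur only as left factors of the
  -- composites on the smaller side.
  ∥≤⇔requirements : ∀ C₁ C₂ D → (C₁ ∥ C₂ ≤ D) ⇔ ParallelRequirements C₁ C₂ D
  ∥≤⇔requirements C₁ C₂ D = mk⇔ to (minimal D)
    where
    requirements = proj₁ (proj₂ (parallel-exists C₁ C₂))
    minimal      = proj₂ (proj₂ (parallel-exists C₁ C₂))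

    to : C₁ ∥ C₂ ≤ D → ParallelRequirements C₁ C₂ D
    to (E≤ , ≤I) with requirements
    ... | I₁I₂≤ , EI₁≤ , EI₂≤ =
        (λ p → ≤I (I₁I₂≤ p))
      , (λ p → EI₁≤ (∥ˢ-monoˡ-⊆ 𝕄 (impl C₁) E≤ p))
      , (λ p → EI₂≤ (∥ˢ-monoˡ-⊆ 𝕄 (impl C₂) E≤ p))

  -- The permutation is cyclic: each requirement moves up one place and the first becomes the last.
  -- The two that involve `I′` as a factor have it on the other side after mirroring, hence
  -- commutativity.
  requirements-mirror : ∀ C C′ C″ →
    ParallelRequirements C C′ C″ ⇔ ParallelRequirements (C″ ⁻¹) C (C′ ⁻¹)
  requirements-mirror C C′ C″ = mk⇔
    (λ (II′≤I″ , E″I≤E′ , E″I′≤E) →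
        (λ p → E″I≤E′ p)
      , (λ p → E″I′≤E (∥ˢ-comm-⊆ 𝕄 (impl C′) (env C″) p))
      , (λ p → II′≤I″ (∥ˢ-comm-⊆ 𝕄 (impl C′) (impl C) p)))
    (λ (E″I≤E′ , I′E″≤E , I′I≤I″) →
        (λ p → I′I≤I″ (∥ˢ-comm-⊆ 𝕄 (impl C) (impl C′) p))
      , (λ p → E″I≤E′ p)
      , (λ p → I′E″≤E (∥ˢ-comm-⊆ 𝕄 (env C″) (impl C′) p)))

  -- Either side consists of the same two inclusions, implementations of each hypercontract in
  -- environments of the other, listed in opposite order.
  ≤-mirror : ∀ C D → (C ≤ D ⁻¹) ⇔ (D ≤ C ⁻¹)
  ≤-mirror C D = mk⇔ swap swap

  mirror-quotient : ∀ C C″ → IsQuotient C″ C ((C″ ⁻¹ ∥ C) ⁻¹)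
  mirror-quotient C C″ C′ = begin
    (C ∥ C′ ≤ C″)                           ≈⟨ ∥≤⇔requirements C C′ C″ ⟩
    ParallelRequirements C C′ C″            ≈⟨ requirements-mirror C C′ C″ ⟩
    ParallelRequirements (C″ ⁻¹) C (C′ ⁻¹)  ≈⟨ ∥≤⇔requirements (C″ ⁻¹) C (C′ ⁻¹) ⟨
    (C″ ⁻¹ ∥ C ≤ C′ ⁻¹)                     ≈⟨ ≤-mirror C′ (C″ ⁻¹ ∥ C) ⟨
    (C′ ≤ (C″ ⁻¹ ∥ C) ⁻¹)                   ∎
    where open SetoidReasoning (⇔-setoid ℓ)

  quotient-unique : ∀ C C″ Q R → IsQuotient C″ C Q → IsQuotient C″ C R → Q ≈ R
  quotient-unique _ _ Q R isQ isR =
    -- `Q ≤ Q` gives `C ∥ Q ≤ C″` by the property of `Q`, and then `Q ≤ R` by that of `R`; the other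
    -- half is symmetric.
    to (isR Q) (from (isQ Q) (refl {Q})) , to (isQ R) (from (isR R) (refl {R}))
    where
    open Equivalence
    open IsLattice isLattice using (refl)

proposition1 : {ℓ s t : Level} {𝕄 : ComponentTheory ℓ} {𝕊 : CompsetTheory 𝕄 s}
    (ℍ : HypercontractTheory 𝕊 t) →
    let open HypercontractTheory ℍ in
    (C C″ : Contr) →
    IsQuotient C″ C ((C″ ⁻¹ ∥ C) ⁻¹) ×
    (∀ Q → IsQuotient C″ C Q → Q ≈ (C″ ⁻¹ ∥ C) ⁻¹)
proposition1 ℍ C C″ =
    mirror-quotient ℍ C C″
  , λ Q isQ → quotient-unique ℍ C C″ Q ((C″ ⁻¹ ∥ C) ⁻¹) isQ (mirror-quotient ℍ C C″)
  where open HypercontractTheory ℍ
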